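{- Let $n$ be a positive even integer. Then there is a balanced Gray code for $\mathcal{P}^{\mathrm{cadj}}_n$: a cyclic listing of all $n!$ permutations of $[n]$ in which consecutive permutations (including the last and the first) differ by a cyclically adjacent transposition, and each of the $n$ cyclically adjacent transpositions is used exactly $\frac{n!}{n}=(n-1)!$ times.
   Context: $S_n$ is the set of permutations of $[n]$ in one-line notation $\pi_1\cdots\pi_n$; applying a transposition $(i,j)$ interchanges the entries $i$ and $j$. The cyclically adjacent transpositions are $(i,i+1)$ for $i\in[n-1]$ together with $(1,n)$. $\mathcal{P}^{\mathrm{cadj}}_n$ is the graph on $S_n$ in which two permutations are adjacent iff they differ by a cyclically adjacent transposition, edges being colored by that transposition. -}

module Defs where

open import Data.Nat using (ℕ; zero; suc)
open import Data.Fin using (Fin; zero; suc; toℕ; fromℕ<)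
open import Data.Nat.DivMod using (m%n<n)
open import Data.Fin.Properties using (_≟_)
open import Data.Vec using (Vec; map; toList)
open import Data.List using (List; length; filter; allFin)
open import Data.List.Relation.Unary.AllPairs using (AllPairs)
open import Data.Bool using (if_then_else_)
open import Relation.Nullary.Decidable using (⌊_⌋)
open import Relation.Binary.PropositionalEquality using (_≡_; _≢_)

-- One-line notation π₁ ⋯ πₙ; entries in Fin n (value i stands for i+1 ∈ [n]).
Perm : ℕ → Set
Perm n = Vec (Fin n) n

IsPerm : ∀ {n} → Perm n → Set
IsPerm π = AllPairs _≢_ (toList π)

swapVal : ∀ {n} → Fin n → Fin n → Perm n → Perm n
swapVal a b = map (λ x → if ⌊ x ≟ a ⌋ then b else (if ⌊ x ≟ b ⌋ then a else x))

csuc : ∀ {n} → Fin n → Fin n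
csuc {suc n} i = fromℕ< (m%n<n (suc (toℕ i)) (suc n))

-- The n cyclically adjacent transpositions, indexed by colour c ∈ Fin n:
-- colour c interchanges values c and (c+1) mod n, i.e. in 1-based terms
-- (c+1, c+2) for c < n-1 and (1, n) for c = n-1.
cadj : ∀ {n} → Fin n → Perm n → Perm n
cadj c = swapVal c (csuc c)

count : ∀ {m n} → (Fin m → Fin n) → Fin n → ℕ
count f c = length (filter (λ k → f k ≟ c) (allFin _))

{-# OPTIONS --safe #-}
module Submission where

-- Read a permutation π through its inverse: a swap of adjacent values becomes a swap of
-- neighbouring letters in a circular word. Write n = m + 1, so m is odd (n = 2 is done by hand).
--
-- Let g act on permutations by increasing every value by 1 modulo n and exchanging the second
-- and third positions. Since n is even, g has order n; it shifts every colour by 1, and the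
-- permutations with first entry 1 meet each orbit once. So it suffices to find a listing
-- B₁, …, B_{m!} of these in which consecutive ones are adjacent and a further edge leads from
-- B_{m!} to g B₁: its n images under the powers of g concatenate to a cyclic listing that uses
-- every colour equally often. (Without the exchange of positions, g would change
-- the parity of π, which is incompatible with the even number m! of steps.)
--
-- Deleting the first entry turns this into a Hamiltonian path on S_m, with non-cyclic adjacent
-- transpositions only, between prescribed end points. View S_m as a grid: the value s at the
-- first position (the slot) and the rest u ∈ S_{m-1} (the column). The prescribed end points are the
-- last and the second slot of the identity column. Order the columns a₀ = id, a₁, a₂, … along a
-- Steinhaus–Johnson–Trotter cycle (also built by a zigzag in such a grid); its first two steps swap
-- values 1, 2 and values 2, 3. Descend a₀ down to slot 3, cross to a₁, descend to slot 1, cross to a₂,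
-- ascend to slot 3, cover the remaining slots of a₁ and a₂ by a ladder, zigzag
-- through a₃, a₄, …, and come back to slots 1 and 2 of a₀. For m = 3 there are only two columns,
-- and a₁ leads straight back to a₀.

open import Defs
open import Data.Nat using (ℕ; zero; suc; _+_; _*_; _≥_; _<_; z≤n; s≤s; _∸_; _!; NonZero; _%_)
open import Data.Nat.Properties using (+-suc; suc-injective; *-comm; +-comm; +-identityʳ; m∸n+n≡m; <⇒≤; <⇒≢; ≤-<-trans; *-suc; m≤n⇒m<n∨m≡n; _!≢0)
open import Data.Nat.DivMod using (m%n%n≡m%n; %-distribˡ-+; m<n⇒m%n≡m; [m+n]%n≡m%n; n%n≡0; m%n*o≡m*o%[n*o])
open import Data.Nat.Divisibility using (divides; m≤n⇒m!∣n!)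
open import Data.Nat.Solver using (module +-*-Solver)
open import Data.Fin using (Fin; zero; suc; toℕ; fromℕ; fromℕ<; cast; punchIn; punchOut; combine; remQuot)
open import Data.Fin.Properties as Fin using (_≟_; punchIn-injective; punchInᵢ≢i; punchIn-punchOut; toℕ-fromℕ; toℕ-fromℕ<; toℕ-injective; toℕ<n; toℕ-cast; cast-involutive; toℕ-combine; combine-surjective; remQuot-combine; combine-injectiveʳ)
open import Data.Bool using (if_then_else_)
open import Data.Vec as Vec using (Vec; []; _∷_; toList; head)
import Data.Vec.Properties as Vec
open import Data.List as List using (List; []; _∷_; _++_; length; lookup; filter; allFin; tabulate; reverse; cartesianProductWith)
import Data.List.Properties as List
open import Data.List.Membership.Propositional using (_∈_)
open import Data.List.Membership.Propositional.Properties using (∈-cartesianProductWith⁺; ∈-allFin; ∈-lookup; ∈-filter⁺; ∈-filter⁻; ∈-map⁺; ∈-map⁻)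
open import Data.List.Membership.Propositional.Properties.WithK using (unique∧set⇒bag)
open import Data.List.Relation.Unary.All as All using (All; []; _∷_)
import Data.List.Relation.Unary.All.Properties as All
open import Data.List.Relation.Unary.AllPairs using (AllPairs; []; _∷_)
open import Data.List.Relation.Unary.Any using (here; index)
open import Data.List.Relation.Unary.Any.Properties using (lookup-index)
open import Data.List.Relation.Unary.Unique.Propositional using (Unique)
import Data.List.Relation.Unary.Unique.Propositional.Properties as Unique
open import Data.List.Relation.Binary.BagAndSetEquality using (∼bag⇒↭)
open import Data.List.Relation.Binary.Permutation.Propositional using (_↭_; ↭⇒↭ₛ; ↭-refl; ↭-sym; ↭-trans; ↭-swap; module PermutationReasoning)
open import Data.List.Relation.Binary.Permutation.Propositional.Properties using (↭-length; ∈-resp-↭; ++⁺; ++⁺ˡ; ++⁺ʳ; ↭-reverse; All-resp-↭; ++-commutativeMonoid; shift)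
open import Data.List.Relation.Binary.Permutation.Setoid.Properties using (Unique-resp-↭)
import Algebra.Solver.CommutativeMonoid as CommutativeMonoidSolver
open import Data.Product using (Σ; ∃; ∃₂; _×_; _,_; proj₁; proj₂)
open import Data.Sum as Sum using (inj₁; inj₂)
open import Function using (_∘_; flip; id; mk⇔)
open import Function.Definitions using (Injective)
open import Relation.Nullary using (yes; no; contradiction)
open import Relation.Nullary.Decidable using (⌊_⌋)
open import Relation.Binary.PropositionalEquality using (_≡_; _≢_; refl; sym; trans; cong; cong₂; subst; setoid; module ≡-Reasoning)

private variable
  A B : Set
  k m n : ℕ

-- Transpositions of values

swp : Fin n → Fin n → Fin n → Fin n
swp a b x = if ⌊ x ≟ a ⌋ then b else (if ⌊ x ≟ b ⌋ then a else x)

swp-left : (a b : Fin n) → swp a b a ≡ b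
swp-left a b with a ≟ a
... | yes _  = refl
... | no a≢a = contradiction refl a≢a

swp-right : (a b : Fin n) → swp a b b ≡ a
swp-right a b with b ≟ a
... | yes b≡a = b≡a
... | no _ with b ≟ b
...   | yes _  = refl
...   | no b≢b = contradiction refl b≢b

swp-other : {a b x : Fin n} → x ≢ a → x ≢ b → swp a b x ≡ x
swp-other {a = a} {b} {x} x≢a x≢b with x ≟ a
... | yes x≡a = contradiction x≡a x≢a
... | no _ with x ≟ b
...   | yes x≡b = contradiction x≡b x≢b
...   | no _    = refl

swp-natural : {f : Fin k → Fin n} → Injective _≡_ _≡_ f →
              ∀ a b x → f (swp a b x) ≡ swp (f a) (f b) (f x)
swp-natural {f = f} f-inj a b x with x ≟ a
... | yes refl = sym (swp-left (f a) (f b))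
... | no x≢a with x ≟ b
...   | yes refl = sym (swp-right (f a) (f b))
...   | no x≢b   = sym (swp-other (x≢a ∘ f-inj) (x≢b ∘ f-inj))

swp-involutive : (a b x : Fin n) → swp a b (swp a b x) ≡ x
swp-involutive a b x with x ≟ a
... | yes refl = swp-right a b
... | no x≢a with x ≟ b
...   | yes refl = swp-left a b
...   | no x≢b   = swp-other x≢a x≢b

-- Relabelling by an injection conjugates a swap. It serves for `punchIn`, when a first entry is
-- inserted, and for `rot`, when values are rotated.
swapVal-natural : {f : Fin k → Fin n} → Injective _≡_ _≡_ f →
                  ∀ a b {l} (u : Vec (Fin k) l) →
                  Vec.map f (Vec.map (swp a b) u) ≡ Vec.map (swp (f a) (f b)) (Vec.map f u)
swapVal-natural {f = f} f-inj a b u = begin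
  Vec.map f (Vec.map (swp a b) u)             ≡⟨ Vec.map-∘ _ _ u ⟨
  Vec.map (f ∘ swp a b) u                     ≡⟨ Vec.map-cong (swp-natural f-inj a b) u ⟩
  Vec.map (swp (f a) (f b) ∘ f) u             ≡⟨ Vec.map-∘ _ _ u ⟩
  Vec.map (swp (f a) (f b)) (Vec.map f u)     ∎
  where open ≡-Reasoning

swapVal-involutive : (a b : Fin n) (u : Perm n) → swapVal a b (swapVal a b u) ≡ u
swapVal-involutive a b u = begin
  Vec.map (swp a b) (Vec.map (swp a b) u)  ≡⟨ Vec.map-∘ _ _ u ⟨
  Vec.map (swp a b ∘ swp a b) u            ≡⟨ Vec.map-cong (swp-involutive a b) u ⟩
  Vec.map id u                             ≡⟨ Vec.map-id u ⟩
  u                                        ∎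
  where open ≡-Reasoning

-- Non-cyclic adjacent transpositions and insertion of a first entry

data Next : Fin n → Fin n → Set where
  zero : Next {suc (suc n)} zero (suc zero)
  suc  : {i j : Fin n} → Next i j → Next (suc i) (suc j)

data Adj (u v : Perm n) : Set where
  step : ∀ {i j} → Next i j → v ≡ swapVal i j u → Adj u v

Adj-sym : {u v : Perm n} → Adj u v → Adj v u
Adj-sym {u = u} (step i→j refl) = step i→j (sym (swapVal-involutive _ _ u))

-- The entry s is the value at the first position; along the inverse permutation,
-- this inserts the letter of that position into slot s.
ins : Fin (suc n) → Perm n → Perm (suc n)
ins s u = s ∷ Vec.map (punchIn s) u

ins-swapVal : (s : Fin (suc n)) (i j : Fin n) (u : Perm n) →
              ins s (swapVal i j u) ≡ swapVal (punchIn s i) (punchIn s j) (ins s u)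
ins-swapVal s i j u = cong₂ _∷_
  (sym (swp-other (punchInᵢ≢i s i ∘ sym) (punchInᵢ≢i s j ∘ sym)))
  (swapVal-natural (punchIn-injective s _ _) i j u)

-- `punchIn s` and `punchIn t` differ only at the argument that the former sends to t and the latter
-- to s. Hence moving a slot by one is an adjacent swap.
swp-punchIn : {s t : Fin (suc n)} → Next s t → ∀ x → punchIn t x ≡ swp s t (punchIn s x)
swp-punchIn zero zero             = refl
swp-punchIn zero (suc x)          = refl
swp-punchIn (suc _) zero          = refl
swp-punchIn (suc {i = i} {j} s→t) (suc x) =
  trans (cong suc (swp-punchIn s→t x)) (swp-natural Fin.suc-injective i j (punchIn i x))

ins-slot-swapVal : {s t : Fin (suc n)} → Next s t → (u : Perm n) → ins t u ≡ swapVal s t (ins s u)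
ins-slot-swapVal {s = s} {t} s→t u = cong₂ _∷_ (sym (swp-left s t))
  (trans (Vec.map-cong (swp-punchIn s→t) u) (Vec.map-∘ _ _ u))

ins-slot : {s t : Fin (suc n)} → Next s t → (u : Perm n) → Adj (ins s u) (ins t u)
ins-slot s→t u = step s→t (ins-slot-swapVal s→t u)

-- In the lowest slot all values of the column shift together, so neighbours stay neighbours; in the
-- top slot none of them moves. These two crossings exist between any adjacent columns, whereas a
-- slot in between may separate the swapped values.
ins-bottom : {u v : Perm n} → Adj u v → Adj (ins zero u) (ins zero v)
ins-bottom {u = u} (step i→j refl) = step (suc i→j) (ins-swapVal zero _ _ u)

punchIn-top : {i j : Fin n} → Next i j → Next (punchIn (fromℕ n) i) (punchIn (fromℕ n) j)
punchIn-top {suc (suc n)} zero   = zero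
punchIn-top {suc n} (suc i→j)    = suc (punchIn-top i→j)

ins-top : {u v : Perm n} → Adj u v → Adj (ins (fromℕ n) u) (ins (fromℕ n) v)
ins-top {n} {u} (step i→j refl) = step (punchIn-top i→j) (ins-swapVal (fromℕ n) _ _ u)

map-injective : {f : A → B} → Injective _≡_ _≡_ f → ∀ {l} → Injective _≡_ _≡_ (Vec.map {n = l} f)
map-injective f-inj {x = []}    {[]}    _  = refl
map-injective f-inj {x = _ ∷ _} {_ ∷ _} eq =
  cong₂ _∷_ (f-inj (Vec.∷-injectiveˡ eq)) (map-injective f-inj (Vec.∷-injectiveʳ eq))

ins-injective : {s t : Fin (suc n)} {u v : Perm n} → ins s u ≡ ins t v → u ≡ v × s ≡ t
ins-injective {s = s} eq with Vec.∷-injectiveˡ eq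
... | refl = map-injective (punchIn-injective s _ _) (Vec.∷-injectiveʳ eq) , refl

Distinct : ∀ {l} → Vec A l → Set
Distinct v = AllPairs _≢_ (toList v)

map-distinct : {f : A → B} → Injective _≡_ _≡_ f → ∀ {l} {v : Vec A l} → Distinct v → Distinct (Vec.map f v)
map-distinct {f = f} f-inj {v = v} d rewrite Vec.toList-map f v = Unique.map⁺ f-inj d

map-distinct⁻ : {f : A → B} → ∀ {l} (v : Vec A l) → Distinct (Vec.map f v) → Distinct v
map-distinct⁻ {f = f} v d rewrite Vec.toList-map f v = Unique.map⁻ d

ins-perm : (s : Fin (suc n)) {u : Perm n} → IsPerm u → IsPerm (ins s u)
ins-perm s {u} p = subst (All (s ≢_)) (sym (Vec.toList-map _ u))
    (All.map⁺ (All.universal (λ x → punchInᵢ≢i s x ∘ sym) (toList u)))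
  ∷ map-distinct (punchIn-injective s _ _) p

punchOut-all : (s : Fin (suc n)) → ∀ {l} (v : Vec (Fin (suc n)) l) →
               All (s ≢_) (toList v) → ∃ λ u → Vec.map (punchIn s) u ≡ v
punchOut-all s []      []          = [] , refl
punchOut-all s (x ∷ v) (s≢x ∷ s≢v) with punchOut-all s v s≢v
... | u , refl = punchOut s≢x ∷ u , cong (_∷ _) (punchIn-punchOut s≢x)

ins-view : (v : Perm (suc n)) → IsPerm v → ∃₂ λ s u → IsPerm u × ins s u ≡ v
ins-view (s ∷ v) (s≢v ∷ d) with punchOut-all s v s≢v
... | u , refl = s , u , map-distinct⁻ u d , refl

-- Walks and the zigzag through columns

data Walk (_~_ : A → A → Set) : A → A → List A → Set where
  [_] : ∀ x → Walk _~_ x x (x ∷ [])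
  _∷_ : ∀ {x y z xs} → x ~ y → Walk _~_ y z xs → Walk _~_ x z (x ∷ xs)

private variable
  _~_ : A → A → Set

infixr 5 _∷_ _++[_]_

_++[_]_ : ∀ {a b c d : A} {xs ys} → Walk _~_ a b xs → b ~ c → Walk _~_ c d ys → Walk _~_ a d (xs ++ ys)
[ _ ]   ++[ s ] w = s ∷ w
(t ∷ v) ++[ s ] w = t ∷ (v ++[ s ] w)

mapWalk : ∀ {_~_ : A → A → Set} {_≈_ : B → B → Set} {f : A → B} → (∀ {x y} → x ~ y → f x ≈ f y) →
       ∀ {a b xs} → Walk _~_ a b xs → Walk _≈_ (f a) (f b) (List.map f xs)
mapWalk g [ x ]   = [ _ ]
mapWalk g (s ∷ w) = g s ∷ mapWalk g w

reverseWalk : (∀ {x y : A} → x ~ y → y ~ x) → ∀ {a b xs} → Walk _~_ a b xs → Walk _~_ b a (reverse xs)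
reverseWalk ~-sym [ x ]   = [ x ]
reverseWalk ~-sym {xs = x ∷ xs} (s ∷ w) rewrite List.unfold-reverse x xs =
  reverseWalk ~-sym w ++[ ~-sym s ] [ x ]

slots : ∀ k → Walk Next zero (fromℕ k) (allFin (suc k))
slots zero    = [ zero ]
-- The tail of `allFin` unfolds to `tabulate suc`, while the mapped walk runs along `map suc`.
slots (suc k) = zero ∷ subst (Walk Next (suc zero) (fromℕ (suc k)))
  (List.map-tabulate {n = suc k} id suc) (mapWalk suc (slots k))

column : List (Fin (suc k)) → Perm k → List (Perm (suc k))
column S u = List.map (λ s → ins s u) S

up down : Perm k → List (Perm (suc k))
up   = column (allFin _)
down = reverse ∘ up

upWalk : (u : Perm k) → Walk Adj (ins zero u) (ins (fromℕ k) u) (up u)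
upWalk {k} u = mapWalk (λ s→t → ins-slot s→t u) (slots k)

downWalk : (u : Perm k) → Walk Adj (ins (fromℕ k) u) (ins zero u) (down u)
downWalk {k} u = reverseWalk Adj-sym (upWalk u)

-- The constructors follow the recursion of `zag` by two columns; an odd number of columns, entered
-- at the top, is left at the bottom.
data Odd {A : Set} : List A → Set where
  one : ∀ {x} → Odd (x ∷ [])
  2+_ : ∀ {x y xs} → Odd xs → Odd (x ∷ y ∷ xs)

odd-length : (xs : List A) (h : ℕ) → length xs ≡ suc (h + h) → Odd xs
odd-length (x ∷ [])     h       eq = one
odd-length (x ∷ y ∷ xs) (suc h) eq =
  2+ odd-length xs h (trans (suc-injective (suc-injective eq)) (+-suc h h))

zag : List (Perm k) → List (Perm (suc k))
zag []           = []
zag (u ∷ [])     = down u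
zag (u ∷ v ∷ us) = down u ++ up v ++ zag us

zagWalk : ∀ {u v : Perm k} {us} → Odd us → Walk Adj u v us → Walk Adj (ins (fromℕ k) u) (ins zero v) (zag us)
zagWalk one [ _ ] = downWalk _
zagWalk (2+ o) (_∷_ {x = u} s (_∷_ {x = v} t w)) =
  downWalk u ++[ ins-bottom s ] (upWalk v ++[ ins-top t ] zagWalk o w)

columns : List (Perm k) → List (Perm (suc k))
columns us = cartesianProductWith (flip ins) us (allFin _)

zag-↭ : (us : List (Perm k)) → zag us ↭ columns us
zag-↭ []           = ↭-refl
zag-↭ (u ∷ [])     = ↭-trans (↭-reverse (up u)) (subst (up u ↭_) (sym (List.++-identityʳ (up u))) ↭-refl)
zag-↭ (u ∷ v ∷ us) = ++⁺ (↭-reverse (up u)) (++⁺ˡ (up v) (zag-↭ us))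

-- Complete listings of permutations

record Enumerates (us : List (Perm k)) : Set where
  field
    size     : length us ≡ k !
    unique   : Unique us
    perms    : All IsPerm us
    complete : ∀ {u} → IsPerm u → u ∈ us
open Enumerates

length-columns : (us : List (Perm k)) → length (columns us) ≡ length us * suc k
length-columns []       = refl
length-columns {k} (u ∷ us) = trans (List.length-++ (up u))
  (cong₂ _+_ (trans (List.length-map (λ s → ins s u) (allFin (suc k))) (List.length-tabulate {n = suc k} id)) (length-columns us))

columns-enumerate : {us : List (Perm k)} → Enumerates us → Enumerates (columns us)
columns-enumerate {k} {us} l .size     = trans (length-columns us) (trans (cong (_* suc k) (l .size)) (*-comm (k !) (suc k)))
columns-enumerate {k} l .unique   = Unique.cartesianProductWith⁺ (flip ins) ins-injective (l .unique) (Unique.allFin⁺ (suc k))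
columns-enumerate {k} {us} l .perms = All.cartesianProductWith⁺ (setoid _) (setoid _) (flip ins) us (allFin _)
  (λ u∈ _ → ins-perm _ (All.lookup (l .perms) u∈))
columns-enumerate l .complete {v} p with ins-view v p
... | s , u , q , refl = ∈-cartesianProductWith⁺ (flip ins) (l .complete q) (∈-allFin s)

Enumerates-resp-↭ : {us vs : List (Perm k)} → us ↭ vs → Enumerates us → Enumerates vs
Enumerates-resp-↭ σ l .size     = trans (sym (↭-length σ)) (l .size)
Enumerates-resp-↭ σ l .unique   = Unique-resp-↭ (setoid _) (↭⇒↭ₛ σ) (l .unique)
Enumerates-resp-↭ σ l .perms    = All-resp-↭ σ (l .perms)
Enumerates-resp-↭ σ l .complete p = ∈-resp-↭ σ (l .complete p)

-- Gray cycles of Steinhaus-Johnson-Trotter type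

ident : ∀ k → Perm k
ident zero    = []
ident (suc k) = ins zero (ident k)

-- The first vertex is kept apart because the next level climbs its column first; the odd number of
-- other columns then brings the zigzag to the lowest slot, where `close` can be lifted.
record Gray (k : ℕ) : Set where
  field
    tail  : List (Perm k)
    final : Perm k
    odd   : Odd tail
    walk  : Walk Adj (ident k) final (ident k ∷ tail)
    close : Adj final (ident k)
    enumerates : Enumerates (ident k ∷ tail)
open Gray

enumerates-empty : Enumerates ([] ∷ [])
enumerates-empty .size              = refl
enumerates-empty .unique            = [] ∷ []
enumerates-empty .perms             = [] ∷ []
enumerates-empty .complete {[]} _   = here refl

-- Since 2! divides (2 + k)!, the whole listing has even length.
odd-tail : {u : Perm (2 + k)} {us : List (Perm (2 + k))} → Enumerates (u ∷ us) → Odd us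
odd-tail {k} {us = us} l with m≤n⇒m!∣n! {2} {2 + k} (s≤s (s≤s z≤n))
... | divides zero    eq with () ← trans (l .size) eq
... | divides (suc h) eq = odd-length us h (suc-injective
  (trans (trans (l .size) eq) (cong (2 +_) (trans (*-comm h 2) (cong (h +_) (+-identityʳ h))))))

grayBase : Gray 2
grayBase .tail  = (suc zero ∷ zero ∷ []) ∷ []
grayBase .final = suc zero ∷ zero ∷ []
grayBase .odd   = one
grayBase .walk  = ins-slot zero _ ∷ [ _ ]
grayBase .close = Adj-sym (ins-slot zero _)
grayBase .enumerates = columns-enumerate (columns-enumerate enumerates-empty)

grayStep : Gray (2 + k) → Gray (3 + k)
grayStep {k} g = record
  { tail  = tail′
  ; final = ins zero (g .final)
  ; odd   = odd-tail enumerates′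
  ; walk  = walk′ (g .odd) (g .walk)
  ; close = ins-bottom (g .close)
  ; enumerates = enumerates′
  }
  where
  tail′ : List (Perm (3 + k))
  -- Slot zero of the first column is the starting vertex `ident (3 + k)`, so the tail takes only
  -- the higher slots.
  tail′ = column (tabulate suc) (ident (2 + k)) ++ zag (g .tail)

  enumerates′ : Enumerates (ident (3 + k) ∷ tail′)
  enumerates′ = Enumerates-resp-↭ (++⁺ˡ (up _) (↭-sym (zag-↭ (g .tail)))) (columns-enumerate (g .enumerates))

  walk′ : ∀ {u v us} → Odd us → Walk Adj u v (u ∷ us) → Walk Adj (ins zero u) (ins zero v) (up u ++ zag us)
  walk′ o (s ∷ w) = upWalk _ ++[ ins-top s ] zagWalk o w

gray : ∀ k → Gray (2 + k)
gray zero    = grayBase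
gray (suc k) = grayStep (gray k)

-- Hamiltonian paths with prescribed end points

ladder : Perm k → Perm k → List (Fin (suc k)) → List (Perm (suc k))
ladder u v []          = []
ladder u v (r ∷ [])    = ins r v ∷ ins r u ∷ []
ladder u v (r ∷ s ∷ S) = ins r v ∷ ins r u ∷ ins s u ∷ ins s v ∷ ladder u v S

-- The walk starts on `v` one slot below the ladder and is back on `v` after every two slots. The
-- odd count includes the starting slot, so the ladder consists of full pairs and ends on `v`.
ladderWalk : ∀ {u v : Perm k} {s t S} → Odd (s ∷ S) → Walk Next s t (s ∷ S) →
             All (λ r → Adj (ins r u) (ins r v)) S →
             Walk Adj (ins s v) (ins t v) (ins s v ∷ ladder u v S)
ladderWalk one    [ _ ]                     []      = [ _ ]
-- Matching on the rest of the walk exposes its next slot as the head of the list.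
ladderWalk (2+ o) (s→q ∷ (q→r ∷ [ _ ]))   (c ∷ d ∷ cs) =
  ins-slot s→q _ ∷ Adj-sym c ∷ ins-slot q→r _ ∷ d ∷ ladderWalk o [ _ ] cs
ladderWalk (2+ o) (s→q ∷ (q→r ∷ w@(_ ∷ _))) (c ∷ d ∷ cs) =
  ins-slot s→q _ ∷ Adj-sym c ∷ ins-slot q→r _ ∷ d ∷ ladderWalk o w cs

ladder-↭ : ∀ (u v : Perm k) S → ladder u v S ↭ column S u ++ column S v
ladder-↭ u v []          = ↭-refl
ladder-↭ u v (r ∷ [])    = ↭-swap _ _ ↭-refl
ladder-↭ u v (r ∷ s ∷ S) = begin
  ins r v ∷ ins r u ∷ ins s u ∷ ins s v ∷ ladder u v S
    ↭⟨ ++⁺ˡ (_ ∷ _ ∷ _ ∷ _ ∷ []) (ladder-↭ u v S) ⟩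
  ins r v ∷ ins r u ∷ ins s u ∷ ins s v ∷ column S u ++ column S v
    ↭⟨ shift (ins r v) (ins r u ∷ ins s u ∷ []) _ ⟨
  ins r u ∷ ins s u ∷ ins r v ∷ ins s v ∷ column S u ++ column S v
    ↭⟨ ++⁺ˡ (_ ∷ _ ∷ []) (regroup (ins r v ∷ ins s v ∷ []) (column S u) (column S v)) ⟩
  column (r ∷ s ∷ S) u ++ column (r ∷ s ∷ S) v ∎
  where
  open PermutationReasoning
  regroup : ∀ (xs ys zs : List A) → xs ++ ys ++ zs ↭ ys ++ xs ++ zs
  regroup xs ys zs = solve 3 (λ x y z → (x ⊕ (y ⊕ z)) ⊜ (y ⊕ (x ⊕ z))) ↭-refl xs ys zs
    where open CommutativeMonoidSolver ++-commutativeMonoid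

-- Here m is 2 + k, with slots and values counted from zero. These end points are the ones that
-- `turnover` joins.
record HamPath (k : ℕ) : Set where
  field
    path  : List (Perm (2 + k))
    walk  : Walk Adj (ins (fromℕ (suc k)) (ident (suc k))) (ins (suc zero) (ident (suc k))) path
    enumerates : Enumerates path
open HamPath

-- Here m is 5 + 2h. A `grayStep` cycle begins by climbing a column, so its first three vertices are
-- known: `a₀`, `a₁`, `a₂`.
hamPath : ∀ h → HamPath (3 + (h + h))
hamPath h = record
  { path  = path′
  ; walk  = walk′ (grayStep g .walk) (grayStep g .close)
  ; enumerates = Enumerates-resp-↭ path-↭ (columns-enumerate (grayStep g .enumerates))
  }
  where
  j : ℕ
  j = suc (h + h)

  g : Gray (2 + j)
  g = gray j

  a₀ a₁ a₂ : Perm (3 + j)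
  a₀ = ins zero (ident (2 + j))
  a₁ = ins (suc zero) (ident (2 + j))
  a₂ = ins (suc (suc zero)) (ident (2 + j))

  a₀₁ : a₁ ≡ swapVal zero (suc zero) a₀
  a₀₁ = ins-slot-swapVal zero (ident (2 + j))

  a₁₂ : a₂ ≡ swapVal (suc zero) (suc (suc zero)) a₁
  a₁₂ = ins-slot-swapVal (suc zero) (ident (2 + j))

  R : List (Perm (3 + j))
  R = column (tabulate (λ i → suc (suc (suc i)))) (ident (2 + j)) ++ zag (g .tail)

  S : List (Fin (4 + j))
  S = tabulate (λ i → suc (suc (suc i)))

  S₂ : List (Fin (4 + j))
  S₂ = suc (suc zero) ∷ S

  oddS₂ : Odd S₂
  -- All 5 + 2h slots but the two lowest: 2h + 3 of them.
  oddS₂ = odd-length S₂ (suc h) (cong suc (trans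
    (List.length-tabulate {n = suc j} (λ i → suc (suc (suc i)))) (cong suc (sym (+-suc h h)))))

  oddR : Odd R
  oddR with 2+ o ← grayStep g .odd = o

  -- `a₁` and `a₂` differ by a swap of the values 1 and 2; a slot from 3 on lies above both and does
  -- not separate them.
  cross : All (λ r → Adj (ins r a₁) (ins r a₂)) S
  cross = All.tabulate⁺ (λ i → step (suc zero)
    (trans (cong (ins _) a₁₂) (ins-swapVal (suc (suc (suc i))) (suc zero) (suc (suc zero)) a₁)))

  turn end : List (Perm (4 + j))
  turn = ins (suc (suc zero)) a₁ ∷ ins (suc zero) a₁ ∷ ins zero a₁
    ∷ ins zero a₂ ∷ ins (suc zero) a₂ ∷ ins (suc (suc zero)) a₂ ∷ []
  end = ins zero a₀ ∷ ins (suc zero) a₀ ∷ []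

  path′ : List (Perm (4 + j))
  path′ = reverse (column S₂ a₀) ++ (turn ++ ladder a₁ a₂ S) ++ zag R ++ end

  slots₂ : Walk Next (suc (suc zero)) (fromℕ (3 + j)) S₂
  slots₂ = subst (Walk Next _ _) (List.map-tabulate {n = 2 + j} (λ i → i) (λ i → suc (suc i)))
    (mapWalk {f = λ i → suc (suc i)} (λ s→t → suc (suc s→t)) (slots (suc j)))

  walk′ : ∀ {v} → Walk Adj a₀ v (a₀ ∷ a₁ ∷ a₂ ∷ R) → Adj v a₀ →
          Walk Adj (ins (fromℕ (3 + j)) a₀) (ins (suc zero) a₀) path′
  walk′ (e₀₁ ∷ e₁₂ ∷ e₂₃ ∷ w) e =
    reverseWalk Adj-sym (mapWalk (λ s→t → ins-slot s→t a₀) slots₂)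
    -- A crossing away from the ends: slot 2 lies above the values 0 and 1 whose swap relates `a₀`
    -- and `a₁`.
    ++[ step zero (trans (cong (ins _) a₀₁) (ins-swapVal (suc (suc zero)) zero (suc zero) a₀)) ]
    ((Adj-sym (ins-slot (suc zero) a₁) ∷ Adj-sym (ins-slot zero a₁) ∷ ins-bottom e₁₂
      ∷ ins-slot zero a₂ ∷ ins-slot (suc zero) a₂ ∷ ladderWalk oddS₂ slots₂ cross)
    ++[ ins-top e₂₃ ]
    (zagWalk oddR w
    ++[ ins-bottom e ]
    (ins-slot zero a₀ ∷ [ _ ])))

  path-↭ : columns (a₀ ∷ a₁ ∷ a₂ ∷ R) ↭ path′
  path-↭ = ↭-sym (begin
    path′
      ↭⟨ ++⁺ (↭-reverse (column S₂ a₀)) (++⁺ (++⁺ˡ turn (ladder-↭ a₁ a₂ S)) (++⁺ʳ end (zag-↭ R))) ⟩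
    column S₂ a₀ ++ (turn ++ column S a₁ ++ column S a₂) ++ columns R ++ end
      ↭⟨ regroup (ins zero a₀) (ins (suc zero) a₀) (column S₂ a₀)
           (ins zero a₁) (ins (suc zero) a₁) (ins (suc (suc zero)) a₁) (column S a₁)
           (ins zero a₂) (ins (suc zero) a₂) (ins (suc (suc zero)) a₂) (column S a₂) (columns R) ⟩
    columns (a₀ ∷ a₁ ∷ a₂ ∷ R) ∎)
    where
    open PermutationReasoning
    regroup : ∀ (p q : A) P (a b c : A) U (x y z : A) V Z →
              P ++ ((c ∷ b ∷ a ∷ x ∷ y ∷ z ∷ []) ++ U ++ V) ++ Z ++ (p ∷ q ∷ []) ↭
              (p ∷ q ∷ P) ++ (a ∷ b ∷ c ∷ U) ++ (x ∷ y ∷ z ∷ V) ++ Z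
    regroup p q P a b c U x y z V Z = solve 12
      (λ p q P a b c U x y z V Z →
        (P ⊕ ((c ⊕ (b ⊕ (a ⊕ (x ⊕ (y ⊕ z))))) ⊕ (U ⊕ V)) ⊕ (Z ⊕ (p ⊕ q))) ⊜
        ((p ⊕ (q ⊕ P)) ⊕ ((a ⊕ (b ⊕ (c ⊕ U))) ⊕ ((x ⊕ (y ⊕ (z ⊕ V))) ⊕ Z))))
      ↭-refl (p ∷ []) (q ∷ []) P (a ∷ []) (b ∷ []) (c ∷ []) U (x ∷ []) (y ∷ []) (z ∷ []) V Z
      where open CommutativeMonoidSolver ++-commutativeMonoid

-- Rotation of values modulo n

%-+ʳ : ∀ a b n .{{_ : NonZero n}} → (a + b % n) % n ≡ (a + b) % n
%-+ʳ a b n = begin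
  (a + b % n) % n          ≡⟨ %-distribˡ-+ a (b % n) n ⟩
  (a % n + b % n % n) % n  ≡⟨ cong (λ x → (a % n + x) % n) (m%n%n≡m%n b n) ⟩
  (a % n + b % n) % n      ≡⟨ %-distribˡ-+ a b n ⟨
  (a + b) % n              ∎
  where open ≡-Reasoning

toℕ-csuc : .{{_ : NonZero n}} (x : Fin n) → toℕ (csuc x) ≡ suc (toℕ x) % n
toℕ-csuc {suc n} x = toℕ-fromℕ< _

-- By `toℕ-rot` this is addition of q modulo n. So `rot (toℕ x) y` is a sum of residues, and
-- `unrot x c` is the difference c - x.
rot : ℕ → Fin n → Fin n
rot zero    x = x
rot (suc q) x = rot q (csuc x)

toℕ-rot : ∀ q (x : Fin (suc m)) → toℕ (rot q x) ≡ (q + toℕ x) % suc m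
toℕ-rot zero    x = sym (m<n⇒m%n≡m (toℕ<n x))
toℕ-rot {m} (suc q) x = begin
  toℕ (rot q (csuc x))                  ≡⟨ toℕ-rot q (csuc x) ⟩
  (q + toℕ (csuc x)) % suc m            ≡⟨ cong (λ y → (q + y) % suc m) (toℕ-csuc x) ⟩
  (q + suc (toℕ x) % suc m) % suc m     ≡⟨ %-+ʳ q (suc (toℕ x)) (suc m) ⟩
  (q + suc (toℕ x)) % suc m             ≡⟨ cong (_% suc m) (+-suc q (toℕ x)) ⟩
  (suc q + toℕ x) % suc m               ∎
  where open ≡-Reasoning

rot-csuc : ∀ q (x : Fin n) → rot q (csuc x) ≡ csuc (rot q x)
rot-csuc zero    x = refl
rot-csuc (suc q) x = rot-csuc q (csuc x)

rot-+ : ∀ p q (x : Fin n) → rot (p + q) x ≡ rot q (rot p x)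
rot-+ zero    q x = refl
rot-+ (suc p) q x = rot-+ p q (csuc x)

rot-full : (x : Fin (suc m)) → rot (suc m) x ≡ x
rot-full {m} x = toℕ-injective (begin
  toℕ (rot (suc m) x)        ≡⟨ toℕ-rot (suc m) x ⟩
  (suc m + toℕ x) % suc m    ≡⟨ cong (_% suc m) (+-comm (suc m) (toℕ x)) ⟩
  (toℕ x + suc m) % suc m    ≡⟨ [m+n]%n≡m%n (toℕ x) (suc m) ⟩
  toℕ x % suc m              ≡⟨ m<n⇒m%n≡m (toℕ<n x) ⟩
  toℕ x                      ∎)
  where open ≡-Reasoning

rot-zero : (x : Fin (suc m)) → rot (toℕ x) zero ≡ x
rot-zero {m} x = toℕ-injective (trans (toℕ-rot (toℕ x) zero)
  (trans (cong (_% suc m) (+-identityʳ (toℕ x))) (m<n⇒m%n≡m (toℕ<n x))))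

-- A further m steps complete a full turn and so undo `csuc`.
csuc-injective : Injective _≡_ _≡_ (csuc {suc m})
csuc-injective {m} {x} {y} eq = trans (sym (rot-full x)) (trans (cong (rot m) eq) (rot-full y))

rot-injective : ∀ q → Injective _≡_ _≡_ (rot {suc m} q)
rot-injective zero    eq = eq
rot-injective (suc q) eq = csuc-injective (rot-injective q eq)

unrot : Fin (suc m) → Fin (suc m) → Fin (suc m)
unrot {m} x = rot (suc m ∸ toℕ x)

rot-unrot : (x y : Fin (suc m)) → rot (toℕ x) (unrot x y) ≡ y
rot-unrot {m} x y = begin
  rot (toℕ x) (rot (suc m ∸ toℕ x) y)  ≡⟨ rot-+ (suc m ∸ toℕ x) (toℕ x) y ⟨
  rot (suc m ∸ toℕ x + toℕ x) y        ≡⟨ cong (λ p → rot p y) (m∸n+n≡m (<⇒≤ (toℕ<n x))) ⟩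
  rot (suc m) y                        ≡⟨ rot-full y ⟩
  y                                    ∎
  where open ≡-Reasoning

rot-comm : (x y : Fin (suc m)) → rot (toℕ x) y ≡ rot (toℕ y) x
rot-comm {m} x y = toℕ-injective (begin
  toℕ (rot (toℕ x) y)        ≡⟨ toℕ-rot (toℕ x) y ⟩
  (toℕ x + toℕ y) % suc m    ≡⟨ cong (_% suc m) (+-comm (toℕ x) (toℕ y)) ⟩
  (toℕ y + toℕ x) % suc m    ≡⟨ toℕ-rot (toℕ y) x ⟨
  toℕ (rot (toℕ y) x)        ∎)
  where open ≡-Reasoning

rot-unrotˡ : (c x : Fin (suc m)) → rot (toℕ (unrot x c)) x ≡ c
rot-unrotˡ c x = trans (rot-comm (unrot x c) x) (rot-unrot x c)

-- Together with `rot-unrotˡ`: exactly one rotation takes colour x to c, which is the source of the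
-- balance.
unrot-unique : (c x q : Fin (suc m)) → rot (toℕ q) x ≡ c → q ≡ unrot x c
unrot-unique c x q eq = rot-injective (toℕ x)
  (trans (rot-comm x q) (trans eq (sym (rot-unrot x c))))

cadj-rot : ∀ q (c : Fin (suc m)) (π : Perm (suc m)) → Vec.map (rot q) (cadj c π) ≡ cadj (rot q c) (Vec.map (rot q) π)
cadj-rot q c π = trans (swapVal-natural (rot-injective q) c (csuc c) π)
  (cong (λ d → swapVal (rot q c) d (Vec.map (rot q) π)) (rot-csuc q c))

-- Exchange of the second and third positions

flip₂ : Vec A (3 + k) → Vec A (3 + k)
flip₂ (a ∷ b ∷ c ∷ v) = a ∷ c ∷ b ∷ v

flip₂^ : ℕ → Vec A (3 + k) → Vec A (3 + k)
flip₂^ zero    v = v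
flip₂^ (suc q) v = flip₂^ q (flip₂ v)

flip₂-involutive : (v : Vec A (3 + k)) → flip₂ (flip₂ v) ≡ v
flip₂-involutive (a ∷ b ∷ c ∷ v) = refl

flip₂^-flip₂ : ∀ q (v : Vec A (3 + k)) → flip₂^ q (flip₂ v) ≡ flip₂ (flip₂^ q v)
flip₂^-flip₂ zero    v = refl
flip₂^-flip₂ (suc q) v = flip₂^-flip₂ q (flip₂ v)

flip₂^-involutive : ∀ q (v : Vec A (3 + k)) → flip₂^ q (flip₂^ q v) ≡ v
flip₂^-involutive zero    v = refl
flip₂^-involutive (suc q) v = begin
  flip₂^ q (flip₂ (flip₂^ q (flip₂ v)))  ≡⟨ cong (flip₂^ q) (flip₂^-flip₂ q (flip₂ v)) ⟨
  flip₂^ q (flip₂^ q (flip₂ (flip₂ v)))  ≡⟨ flip₂^-involutive q _ ⟩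
  flip₂ (flip₂ v)                        ≡⟨ flip₂-involutive v ⟩
  v                                      ∎
  where open ≡-Reasoning

flip₂^-even : ∀ h (v : Vec A (3 + k)) → flip₂^ (h * 2) v ≡ v
flip₂^-even zero    v = refl
flip₂^-even (suc h) v = trans (cong (flip₂^ (h * 2)) (flip₂-involutive v)) (flip₂^-even h v)

-- Positions and values are acted on independently, so the exchange leaves colours alone and the
-- powers of g split into two commuting parts.
flip₂^-map : (f : A → B) → ∀ q (v : Vec A (3 + k)) → flip₂^ q (Vec.map f v) ≡ Vec.map f (flip₂^ q v)
flip₂^-map f zero    v                 = refl
flip₂^-map f (suc q) v@(_ ∷ _ ∷ _ ∷ _) = flip₂^-map f q (flip₂ v)

flip₂^-head : ∀ q (v : Vec A (3 + k)) → head (flip₂^ q v) ≡ head v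
flip₂^-head zero    v                 = refl
flip₂^-head (suc q) v@(_ ∷ _ ∷ _ ∷ _) = flip₂^-head q (flip₂ v)

flip₂^-distinct : ∀ q {v : Vec A (3 + k)} → Distinct v → Distinct (flip₂^ q v)
flip₂^-distinct zero    d = d
flip₂^-distinct (suc q) {_ ∷ _ ∷ _ ∷ _} ((ab ∷ ac ∷ av) ∷ (bc ∷ bv) ∷ cv ∷ d) =
  flip₂^-distinct q ((ac ∷ ab ∷ av) ∷ ((λ cb → bc (sym cb)) ∷ cv) ∷ bv ∷ d)

-- Numbering by blocks, and the count of each colour

csuc-combine-suc : (q : Fin (suc n)) {r r′ : Fin m} → .{{_ : NonZero (suc n * m)}} → toℕ r′ ≡ suc (toℕ r) →
                   csuc (combine q r) ≡ combine q r′
csuc-combine-suc {n} {m} q {r} {r′} eq = toℕ-injective (begin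
  toℕ (csuc (combine q r))               ≡⟨ toℕ-csuc (combine q r) ⟩
  suc (toℕ (combine q r)) % (suc n * m)  ≡⟨ cong (_% (suc n * m)) next ⟩
  toℕ (combine q r′) % (suc n * m)       ≡⟨ m<n⇒m%n≡m (toℕ<n (combine q r′)) ⟩
  toℕ (combine q r′)                     ∎)
  where
  open ≡-Reasoning
  next : suc (toℕ (combine q r)) ≡ toℕ (combine q r′)
  next = begin
    suc (toℕ (combine q r))    ≡⟨ cong suc (toℕ-combine q r) ⟩
    suc (m * toℕ q + toℕ r)    ≡⟨ +-suc (m * toℕ q) (toℕ r) ⟨
    m * toℕ q + suc (toℕ r)    ≡⟨ cong (m * toℕ q +_) eq ⟨
    m * toℕ q + toℕ r′         ≡⟨ toℕ-combine q r′ ⟨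
    toℕ (combine q r′)         ∎

-- The carry. Reducing a multiple of m modulo a multiple of m reduces the block number, so the last
-- block is followed by the first.
csuc-combine-last : (q : Fin (suc n)) {r r′ : Fin m} → .{{_ : NonZero (suc n * m)}} →
                    suc (toℕ r) ≡ m → toℕ r′ ≡ 0 →
                    csuc (combine q r) ≡ combine (csuc q) r′
csuc-combine-last {n} {m} q {r} {r′} last first = toℕ-injective (begin
  toℕ (csuc (combine q r))                 ≡⟨ toℕ-csuc (combine q r) ⟩
  suc (toℕ (combine q r)) % (suc n * m)    ≡⟨ cong (_% (suc n * m)) next ⟩
  (suc (toℕ q) * m) % (suc n * m)          ≡⟨ m%n*o≡m*o%[n*o] (suc (toℕ q)) (suc n) m ⟨
  suc (toℕ q) % suc n * m                  ≡⟨ cong (_* m) (toℕ-csuc q) ⟨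
  toℕ (csuc q) * m                         ≡⟨ *-comm _ m ⟩
  m * toℕ (csuc q)                         ≡⟨ +-identityʳ _ ⟨
  m * toℕ (csuc q) + 0                     ≡⟨ cong (m * toℕ (csuc q) +_) first ⟨
  m * toℕ (csuc q) + toℕ r′                ≡⟨ toℕ-combine (csuc q) r′ ⟨
  toℕ (combine (csuc q) r′)                ∎)
  where
  open ≡-Reasoning
  next : suc (toℕ (combine q r)) ≡ suc (toℕ q) * m
  next = begin
    suc (toℕ (combine q r))    ≡⟨ cong suc (toℕ-combine q r) ⟩
    suc (m * toℕ q + toℕ r)    ≡⟨ +-suc (m * toℕ q) (toℕ r) ⟨
    m * toℕ q + suc (toℕ r)    ≡⟨ cong (m * toℕ q +_) last ⟩
    m * toℕ q + m              ≡⟨ +-comm _ m ⟩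
    m + m * toℕ q              ≡⟨ *-suc m (toℕ q) ⟨
    m * suc (toℕ q)            ≡⟨ *-comm m _ ⟩
    suc (toℕ q) * m            ∎

-- Each offset r has exactly one block in which its colour becomes c, so the indices of colour c
-- correspond to the M offsets. Duplicate-free lists with the same members are equally long.
count-rot : ∀ {n M} (κ : Fin M → Fin (suc n)) (col : Fin (suc n * M) → Fin (suc n)) →
            (∀ q r → col (combine q r) ≡ rot (toℕ q) (κ r)) → ∀ c → count col c ≡ M
count-rot {n} {M} κ col col-combine c = begin
  length (filter _ (allFin (suc n * M)))  ≡⟨ ↭-length (∼bag⇒↭ (unique∧set⇒bag
      (Unique.filter⁺ _ (Unique.allFin⁺ (suc n * M)))
      (Unique.map⁺ (λ {r} {r′} → combine-injectiveʳ (unrot (κ r) c) r (unrot (κ r′) c) r′) (Unique.allFin⁺ M))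
      (mk⇔ to from))) ⟩
  length (List.map solution (allFin M))   ≡⟨ List.length-map solution (allFin M) ⟩
  length (allFin M)                       ≡⟨ List.length-tabulate (λ i → i) ⟩
  M                                       ∎
  where
  open ≡-Reasoning
  solution : Fin M → Fin (suc n * M)
  solution r = combine (unrot (κ r) c) r
  to : ∀ {k} → k ∈ filter (λ k → col k ≟ c) (allFin _) → k ∈ List.map solution (allFin M)
  to {k} k∈ with combine-surjective {suc n} {M} k
  ... | q , r , refl = subst (λ q → combine q r ∈ List.map solution (allFin M))
    (sym (unrot-unique c (κ r) q (trans (sym (col-combine q r)) (proj₂ (∈-filter⁻ _ {xs = allFin _} k∈)))))
    (∈-map⁺ solution (∈-allFin r))
  from : ∀ {k} → k ∈ List.map solution (allFin M) → k ∈ filter (λ k → col k ≟ c) (allFin _)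
  from k∈ with ∈-map⁻ solution k∈
  ... | r , _ , refl = ∈-filter⁺ _ (∈-allFin _) (trans (col-combine (unrot (κ r) c) r) (rot-unrotˡ c (κ r)))

-- From walks to indexed listings

walk-first : ∀ {a b : A} {xs} → Walk _~_ a b xs → ∀ i → toℕ i ≡ 0 → lookup xs i ≡ a
walk-first {xs = _ ∷ _} [ _ ]   zero _ = refl
walk-first (_ ∷ _) zero _ = refl

walk-last : ∀ {a b : A} {xs} → Walk _~_ a b xs → ∀ i → suc (toℕ i) ≡ length xs → lookup xs i ≡ b
walk-last [ _ ]           zero    _  = refl
walk-last (_ ∷ w@([ _ ])) (suc i) eq = walk-last w i (suc-injective eq)
walk-last (_ ∷ (s ∷ w))   (suc i) eq = walk-last (s ∷ w) i (suc-injective eq)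

walk-step : ∀ {a b : A} {xs} → Walk _~_ a b xs → ∀ i j → toℕ j ≡ suc (toℕ i) → lookup xs i ~ lookup xs j
walk-step {_~_ = _~_} {xs = _ ∷ _} (s ∷ w) zero (suc j) eq = subst (_ ~_) (sym (walk-first w j (suc-injective eq))) s
walk-step {xs = _ ∷ _} (s ∷ w) (suc i) (suc j) eq = walk-step w i j (suc-injective eq)

lookup-injective : {xs : List A} → Unique xs → ∀ i j → lookup xs i ≡ lookup xs j → i ≡ j
lookup-injective {xs = _ ∷ _} u zero zero _  = refl
lookup-injective (x≢ ∷ _) zero    (suc j) eq = contradiction eq (All.lookup x≢ (∈-lookup j))
lookup-injective (x≢ ∷ _) (suc i) zero    eq = contradiction (sym eq) (All.lookup x≢ (∈-lookup i))
lookup-injective (_ ∷ u) (suc i) (suc j) eq = cong suc (lookup-injective u i j eq)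

Next-csuc : {i j : Fin n} → Next i j → csuc i ≡ j
Next-csuc {suc n} {i} {j} i→j = toℕ-injective (trans (toℕ-csuc i)
  (trans (cong (_% suc n) (sym (toℕ-Next i→j))) (m<n⇒m%n≡m (toℕ<n j))))
  where
  toℕ-Next : ∀ {n} {i j : Fin n} → Next i j → toℕ j ≡ suc (toℕ i)
  toℕ-Next zero      = refl
  toℕ-Next (suc i→j) = cong suc (toℕ-Next i→j)

Adj-cadj : {u v : Perm n} → Adj u v → ∃ λ c → v ≡ cadj c u
Adj-cadj {u = u} (step {i} i→j eq) = i , trans eq (cong (λ j → swapVal i j u) (sym (Next-csuc i→j)))

-- The edge from the last base permutation to g applied to the first. With values from zero these
-- two are 0 2 1 3 4 ... and 0 (k+2) 1 2 3 ..., and both sides come to 1 2 0 3 4 ... (k+2).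
turnover : ∀ k → cadj zero (ins zero (ins (suc zero) (ident (suc k)))) ≡
                 Vec.map csuc (flip₂ (ins zero (ins (fromℕ (suc k)) (ident (suc k)))))
turnover k = cong₂ _∷_ (sym (Next-csuc zero)) (cong₂ _∷_ (sym (Next-csuc (suc zero))) (cong₂ _∷_ (sym csuc-top)
  (begin
    Vec.map (swp zero (suc zero)) (Vec.map suc (Vec.map (punchIn (suc zero)) (Vec.map suc (ident k))))
      ≡⟨ map-∘₃ _ _ _ _ (ident k) ⟨
    Vec.map (λ x → suc (suc (suc x))) (ident k)
      -- The remaining entries lie below the top value, so `csuc` does not wrap around on them.
      ≡⟨ Vec.map-cong (λ x → sym (Next-csuc (suc (suc (Next-punchIn-top x))))) (ident k) ⟩
    Vec.map (λ x → csuc (suc (punchIn (fromℕ (suc k)) (suc x)))) (ident k)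
      ≡⟨ map-∘₃ csuc suc (punchIn (fromℕ (suc k))) suc (ident k) ⟩
    Vec.map csuc (Vec.map suc (Vec.map (punchIn (fromℕ (suc k))) (Vec.map suc (ident k)))) ∎)))
  where
  open ≡-Reasoning
  map-∘₃ : ∀ {C D E : Set} (f : D → E) (g : C → D) (h : B → C) (i : A → B) {n} (v : Vec A n) →
           Vec.map (λ x → f (g (h (i x)))) v ≡ Vec.map f (Vec.map g (Vec.map h (Vec.map i v)))
  map-∘₃ f g h i v = trans (Vec.map-∘ f _ v) (cong (Vec.map f) (trans (Vec.map-∘ g _ v) (cong (Vec.map g) (Vec.map-∘ h i v))))
  Next-punchIn-top : ∀ {k} (x : Fin k) → Next (punchIn (fromℕ k) x) (suc x)
  Next-punchIn-top zero    = zero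
  Next-punchIn-top (suc x) = suc (Next-punchIn-top x)
  csuc-top : csuc (fromℕ (2 + k)) ≡ zero
  csuc-top = toℕ-injective (trans (toℕ-csuc (fromℕ (2 + k)))
    (trans (cong (λ t → suc t % (3 + k)) (toℕ-fromℕ (2 + k))) (n%n≡0 (3 + k))))

-- For m = 3 the graph is a hexagon with the two end points adjacent; the path takes the long way
-- round.
hamPath₁ : HamPath 1
hamPath₁ = record
  { path  = path′
  ; walk  = ins-top s ∷ Adj-sym (ins-slot (suc zero) v) ∷ Adj-sym (ins-slot zero v)
            ∷ ins-bottom (Adj-sym s) ∷ ins-slot zero u ∷ [ _ ]
  ; enumerates = Enumerates-resp-↭ path-↭ (columns-enumerate (grayBase .enumerates))
  }
  where
  u v : Perm 2
  u = ins zero (ident 1)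
  v = ins (suc zero) (ident 1)

  s : Adj u v
  s = ins-slot zero (ident 1)

  path′ : List (Perm 3)
  path′ = ins (suc (suc zero)) u ∷ ins (suc (suc zero)) v ∷ ins (suc zero) v ∷ ins zero v ∷ ins zero u ∷ ins (suc zero) u ∷ []

  path-↭ : columns (u ∷ v ∷ []) ↭ path′
  path-↭ = solve 6 (λ a b c x y z → (a ⊕ (b ⊕ (c ⊕ (x ⊕ (y ⊕ z))))) ⊜ (c ⊕ (z ⊕ (y ⊕ (x ⊕ (a ⊕ b))))))
    ↭-refl (_ ∷ []) (_ ∷ []) (_ ∷ []) (_ ∷ []) (_ ∷ []) (_ ∷ [])
    where open CommutativeMonoidSolver ++-commutativeMonoid

-- Named so that `subst` can carry the conclusion along an equation between two forms of n.
Balanced : ℕ → Set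
Balanced n =
    Σ (Fin (n !) → Perm n) λ L →
    Σ (Fin (n !) → Fin n) λ col →
      (∀ k → IsPerm (L k))
      × Injective _≡_ _≡_ L
      × (∀ π → IsPerm π → ∃ λ k → L k ≡ π)
      × (∀ k → L (csuc k) ≡ cadj (col k) (L k))
      × (∀ c → count col c ≡ (n ∸ 1) !)

-- Concatenating the images under the powers of g

module Lift {k} (H : HamPath k) (h : ℕ) (even : 3 + k ≡ h * 2) where
  M : ℕ
  M = (2 + k) !

  pos : Fin M → Fin (length (H .path))
  pos = cast (sym (H .enumerates .size))

  base : Fin M → Perm (3 + k)
  base r = ins zero (lookup (H .path) (pos r))

  base-perm : ∀ r → IsPerm (base r)
  base-perm r = ins-perm zero (All.lookup (H .enumerates .perms) (∈-lookup (pos r)))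

  base-injective : Injective _≡_ _≡_ base
  base-injective {r} {r′} eq = toℕ-injective (trans (sym (toℕ-cast _ r)) (trans
    (cong toℕ (lookup-injective (H .enumerates .unique) (pos r) (pos r′) (proj₁ (ins-injective eq)))) (toℕ-cast _ r′)))

  base-complete : ∀ π → IsPerm π → head π ≡ zero → ∃ λ r → base r ≡ π
  base-complete π p eq with ins-view π p
  base-complete π p refl | zero , u , q , refl = cast (H .enumerates .size) i ,
    trans (cong (ins zero ∘ lookup (H .path))
      (cast-involutive (sym (H .enumerates .size)) (H .enumerates .size) i))
      (cong (ins zero) (sym (lookup-index u∈)))
    where
    u∈ = H .enumerates .complete q
    i = index u∈

  -- The last offset receives the colour of the edge in `turnover`; treating both cases at once
  -- yields a single colour function `κ`.
  base-step : ∀ r → ∃ λ c → (∀ r′ → toℕ r′ ≡ suc (toℕ r) → base r′ ≡ cadj c (base r)) × (suc (toℕ r) ≡ M → c ≡ zero)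
  base-step r with m≤n⇒m<n∨m≡n (toℕ<n r)
  ... | inj₁ r+1<M = proj₁ next
    , (λ r′ r′≡ → trans (cong base (toℕ-injective (trans r′≡ (sym (toℕ-fromℕ< r+1<M))))) (proj₂ next))
    , (λ r+1≡M → contradiction r+1≡M (<⇒≢ r+1<M))
    where
    r⁺ : Fin M
    r⁺ = fromℕ< r+1<M
    next : ∃ λ c → base r⁺ ≡ cadj c (base r)
    next = Adj-cadj (ins-bottom (walk-step (H .walk) (pos r) (pos r⁺)
      (trans (toℕ-cast _ r⁺) (trans (toℕ-fromℕ< r+1<M) (cong suc (sym (toℕ-cast _ r)))))))
  ... | inj₂ r+1≡M = zero
    , (λ r′ r′≡ → contradiction (trans r′≡ r+1≡M) (<⇒≢ (toℕ<n r′)))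
    , (λ _ → refl)

  base-close : ∀ r r′ → suc (toℕ r) ≡ M → toℕ r′ ≡ 0 → cadj zero (base r) ≡ Vec.map csuc (flip₂ (base r′))
  base-close r r′ last first = begin
    cadj zero (base r)   ≡⟨ cong (cadj zero ∘ ins zero) (walk-last (H .walk) (pos r)
                           (trans (cong suc (toℕ-cast _ r)) (trans last (sym (H .enumerates .size))))) ⟩
    cadj zero (ins zero (ins (suc zero) (ident (suc k))))                 ≡⟨ turnover k ⟩
    Vec.map csuc (flip₂ (ins zero (ins (fromℕ (suc k)) (ident (suc k))))) ≡⟨ cong (Vec.map csuc ∘ flip₂ ∘ ins zero)
                           (walk-first (H .walk) (pos r′) (trans (toℕ-cast _ r′) first)) ⟨
    Vec.map csuc (flip₂ (base r′)) ∎
    where open ≡-Reasoning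

  -- The power g^q, with its two commuting parts iterated separately.
  act : ℕ → Perm (3 + k) → Perm (3 + k)
  act q π = Vec.map (rot q) (flip₂^ q π)

  act-cadj : ∀ q c π → act q (cadj c π) ≡ cadj (rot q c) (act q π)
  act-cadj q c π = trans (cong (Vec.map (rot q)) (flip₂^-map _ q π)) (cadj-rot q c (flip₂^ q π))

  act-suc : ∀ q π → act q (Vec.map csuc (flip₂ π)) ≡ act (suc q) π
  act-suc q π = trans (cong (Vec.map (rot q)) (flip₂^-map csuc q (flip₂ π))) (sym (Vec.map-∘ (rot q) csuc _))

  act-csuc : ∀ (q : Fin (3 + k)) π → act (suc (toℕ q)) π ≡ act (toℕ (csuc q)) π
  act-csuc q π with m≤n⇒m<n∨m≡n (toℕ<n q)
  ... | inj₁ q+1<n = cong (λ p → act p π) (sym (trans (toℕ-csuc q) (m<n⇒m%n≡m q+1<n)))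
  ... | inj₂ q+1≡n = begin
    act (suc (toℕ q)) π                   ≡⟨ cong (λ p → act p π) q+1≡n ⟩
    act (3 + k) π                         ≡⟨ Vec.map-cong rot-full _ ⟩
    Vec.map (λ x → x) (flip₂^ (3 + k) π)  ≡⟨ Vec.map-id _ ⟩
    -- Evenness of n enters here: the exchanges cancel in pairs, so g^n is the identity.
    flip₂^ (3 + k) π                      ≡⟨ cong (λ p → flip₂^ p π) even ⟩
    flip₂^ (h * 2) π                      ≡⟨ flip₂^-even h π ⟩
    π                                     ≡⟨ Vec.map-id π ⟨
    act 0 π                               ≡⟨ cong (λ p → act p π) (trans (toℕ-csuc q) (trans (cong (_% (3 + k)) q+1≡n) (n%n≡0 (3 + k)))) ⟨
    act (toℕ (csuc q)) π                  ∎
    where open ≡-Reasoning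

  κ : Fin M → Fin (3 + k)
  κ r = proj₁ (base-step r)

  F : Fin (3 + k) × Fin M → Perm (3 + k)
  F (q , r) = act (toℕ q) (base r)

  colour : Fin (3 + k) × Fin M → Fin (3 + k)
  colour (q , r) = rot (toℕ q) (κ r)

  -- `(3 + k) !` unfolds to (3 + k) * M, so `remQuot` splits an index into block and offset.
  L : Fin ((3 + k) !) → Perm (3 + k)
  L = F ∘ remQuot M

  col : Fin ((3 + k) !) → Fin (3 + k)
  col = colour ∘ remQuot M

  -- Base permutations start with 0 and the exchange fixes the first position; so the first entry
  -- identifies the block.
  head-F : ∀ q r → head (F (q , r)) ≡ q
  head-F q r = begin
    head (Vec.map (rot (toℕ q)) (flip₂^ (toℕ q) (base r)))  ≡⟨ head-map (rot (toℕ q)) (flip₂^ (toℕ q) (base r)) ⟩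
    rot (toℕ q) (head (flip₂^ (toℕ q) (base r)))            ≡⟨ cong (rot (toℕ q)) (flip₂^-head (toℕ q) (base r)) ⟩
    rot (toℕ q) zero                                        ≡⟨ rot-zero q ⟩
    q                                                       ∎
    where
    open ≡-Reasoning
    head-map : ∀ {n} (f : A → B) (v : Vec A (suc n)) → head (Vec.map f v) ≡ f (head v)
    head-map f (_ ∷ _) = refl

  F-perm : ∀ qr → IsPerm (F qr)
  F-perm (q , r) = map-distinct (rot-injective (toℕ q)) (flip₂^-distinct (toℕ q) (base-perm r))

  F-injective : ∀ q r q′ r′ → F (q , r) ≡ F (q′ , r′) → q ≡ q′ × r ≡ r′
  F-injective q r q′ r′ eq with trans (sym (head-F q r)) (trans (cong head eq) (head-F q′ r′))
  ... | refl = refl , base-injective (begin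
    base r                                     ≡⟨ flip₂^-involutive (toℕ q) (base r) ⟨
    flip₂^ (toℕ q) (flip₂^ (toℕ q) (base r))   ≡⟨ cong (flip₂^ (toℕ q)) (map-injective (rot-injective (toℕ q)) eq) ⟩
    flip₂^ (toℕ q) (flip₂^ (toℕ q) (base r′))  ≡⟨ flip₂^-involutive (toℕ q) (base r′) ⟩
    base r′                                    ∎)
    where open ≡-Reasoning

  L-combine : ∀ q r → L (combine q r) ≡ F (q , r)
  L-combine q r = cong F (remQuot-combine q r)

  col-combine : ∀ q r → col (combine q r) ≡ rot (toℕ q) (κ r)
  col-combine q r = cong colour (remQuot-combine q r)

  F-complete : ∀ π → IsPerm π → ∃₂ λ q r → F (q , r) ≡ π
  -- The base point is the image of π under g^(-q): `unrot q` takes the first entry to zero, and the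
  -- iterated exchange is its own inverse.
  F-complete π@(q ∷ _) p with base-complete (flip₂^ (toℕ q) (Vec.map (unrot q) π))
        (flip₂^-distinct (toℕ q) (map-distinct (rot-injective (suc (2 + k) ∸ toℕ q)) p))
        (trans (flip₂^-head (toℕ q) (Vec.map (unrot q) π)) (rot-injective (toℕ q) (trans (rot-unrot q q) (sym (rot-zero q)))))
  ... | r , eq = q , r , (begin
    Vec.map (rot (toℕ q)) (flip₂^ (toℕ q) (base r))                                ≡⟨ cong (act (toℕ q)) eq ⟩
    Vec.map (rot (toℕ q)) (flip₂^ (toℕ q) (flip₂^ (toℕ q) (Vec.map (unrot q) π)))  ≡⟨ cong (Vec.map (rot (toℕ q))) (flip₂^-involutive (toℕ q) _) ⟩
    Vec.map (rot (toℕ q)) (Vec.map (unrot q) π)                                    ≡⟨ Vec.map-∘ _ _ π ⟨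
    Vec.map (rot (toℕ q) ∘ unrot q) π                                              ≡⟨ Vec.map-cong (rot-unrot q) π ⟩
    Vec.map (λ x → x) π                                                            ≡⟨ Vec.map-id π ⟩
    π                                                                              ∎)
    where open ≡-Reasoning

  L-step : ∀ q r → L (csuc (combine q r)) ≡ cadj (rot (toℕ q) (κ r)) (F (q , r))
  L-step q r = Sum.[ inner , last ]′ (m≤n⇒m<n∨m≡n (toℕ<n r))
    where
    open ≡-Reasoning
    instance _ = (3 + k) !≢0

    inner : suc (toℕ r) < M → L (csuc (combine q r)) ≡ cadj (rot (toℕ q) (κ r)) (F (q , r))
    inner r+1<M = begin
      L (csuc (combine q r))                ≡⟨ cong L (csuc-combine-suc q (toℕ-fromℕ< r+1<M)) ⟩
      L (combine q (fromℕ< r+1<M))          ≡⟨ L-combine q _ ⟩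
      act (toℕ q) (base (fromℕ< r+1<M))     ≡⟨ cong (act (toℕ q)) (proj₁ (proj₂ (base-step r)) _ (toℕ-fromℕ< r+1<M)) ⟩
      act (toℕ q) (cadj (κ r) (base r))     ≡⟨ act-cadj (toℕ q) (κ r) (base r) ⟩
      cadj (rot (toℕ q) (κ r)) (F (q , r))  ∎

    -- At the end of block q the closing edge is transported by g^q; its target becomes g^(q+1)
    -- applied to the first base permutation, the start of the next block.
    last : suc (toℕ r) ≡ M → L (csuc (combine q r)) ≡ cadj (rot (toℕ q) (κ r)) (F (q , r))
    last r+1≡M = begin
      L (csuc (combine q r))                        ≡⟨ cong L (csuc-combine-last q r+1≡M r₀≡0) ⟩
      L (combine (csuc q) r₀)                       ≡⟨ L-combine (csuc q) r₀ ⟩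
      act (toℕ (csuc q)) (base r₀)                  ≡⟨ act-csuc q (base r₀) ⟨
      act (suc (toℕ q)) (base r₀)                   ≡⟨ act-suc (toℕ q) (base r₀) ⟨
      act (toℕ q) (Vec.map csuc (flip₂ (base r₀)))  ≡⟨ cong (act (toℕ q)) (base-close r r₀ r+1≡M r₀≡0) ⟨
      act (toℕ q) (cadj zero (base r))              ≡⟨ act-cadj (toℕ q) zero (base r) ⟩
      cadj (rot (toℕ q) zero) (F (q , r))           ≡⟨ cong (λ c → cadj (rot (toℕ q) c) (F (q , r))) (proj₂ (proj₂ (base-step r)) r+1≡M) ⟨
      cadj (rot (toℕ q) (κ r)) (F (q , r))          ∎
      where
      0<M : 0 < M
      0<M = ≤-<-trans z≤n (toℕ<n r)
      r₀ : Fin M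
      r₀ = fromℕ< 0<M
      r₀≡0 : toℕ r₀ ≡ 0
      r₀≡0 = toℕ-fromℕ< 0<M

  balanced : Balanced (3 + k)
  balanced = L , col , perm , inj , surj , stp , count-rot κ col col-combine
    where
    perm : ∀ i → IsPerm (L i)
    perm i = F-perm (remQuot M i)
    inj : Injective _≡_ _≡_ L
    inj {i} {j} eq with combine-surjective {3 + k} {M} i | combine-surjective {3 + k} {M} j
    ... | q , r , refl | q′ , r′ , refl with F-injective q r q′ r′ (trans (sym (L-combine q r)) (trans eq (L-combine q′ r′)))
    ...   | refl , refl = refl
    surj : ∀ π → IsPerm π → ∃ λ i → L i ≡ π
    surj π p with F-complete π p
    ... | q , r , eq = combine q r , trans (L-combine q r) eq
    stp : ∀ i → L (csuc i) ≡ cadj (col i) (L i)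
    stp i with combine-surjective {3 + k} {M} i
    ... | q , r , refl = trans (L-step q r) (sym (cong₂ cadj (col-combine q r) (L-combine q r)))

-- Two values, and all even n

balanced₂ : Balanced 2
balanced₂ = L , (λ i → i) , perm , inj , surj , step₂ , (λ { zero → refl ; (suc zero) → refl })
  where
  L : Fin 2 → Perm 2
  L i = ins i (ident 1)
  perm : ∀ i → IsPerm (L i)
  perm i = ins-perm i ([] ∷ [])
  inj : Injective _≡_ _≡_ L
  inj = proj₂ ∘ ins-injective
  surj : ∀ π → IsPerm π → ∃ λ i → L i ≡ π
  surj π p with ins-view π p
  ... | i , zero ∷ [] , _ , eq = i , eq
  -- Both colours swap the same two values: one leads to the other permutation, the other leads
  -- back.
  step₂ : ∀ i → L (csuc i) ≡ cadj i (L i)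
  step₂ zero       = refl
  step₂ (suc zero) = refl

theorem2p3 : (n : ℕ) → n ≥ 1 → (∃ λ m → n ≡ 2 * m) →
    Σ (Fin (n !) → Perm n) λ L →
    Σ (Fin (n !) → Fin n) λ col →
    (∀ k → IsPerm (L k))
    × Injective _≡_ _≡_ L
    × (∀ π → IsPerm π → ∃ λ k → L k ≡ π)
    × (∀ k → L (csuc k) ≡ cadj (col k) (L k))
    × (∀ c → count col c ≡ (n ∸ 1) !)
theorem2p3 _ ()  (0 , refl)
theorem2p3 _ n≥1 (1 , refl) = balanced₂
theorem2p3 _ n≥1 (2 , refl) = Lift.balanced hamPath₁ 2 refl
-- Here n = 6 + 2h, so m = 5 + 2h is the size that `hamPath h` covers.
theorem2p3 _ n≥1 (suc (suc (suc h)) , refl) = subst Balanced eq (Lift.balanced (hamPath h) (3 + h) (trans eq (*-comm 2 (3 + h))))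
  where
  eq : 3 + (3 + (h + h)) ≡ 2 * (3 + h)
  eq = solve 1 (λ h → con 6 :+ (h :+ h) := con 2 :* (con 3 :+ h)) refl h
    where open +-*-Solver
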